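{- For every graph $H$, integer $k\ge 1$, and family of graphs $\mathcal{F}$, either $\mathrm{ex}(n,H,\mathcal{F})=\Omega_{H,k}(n^k)$ or there exists a positive integer $q$ such that every $\mathcal{F}$-free graph is also $\mathcal{F}_{H,k}^q$-free. In particular, either $\mathrm{ex}(n,H,\mathcal{F})=\Omega_{H,k}(n^k)$ or there exists a positive integer $q$ such that $\mathrm{ex}(n,H,\mathcal{F})\le \mathrm{ex}(n,H,\mathcal{F}_{H,k}^q)$ for all $n$.
   Context: Graphs are finite and simple. A graph is $\mathcal{F}$-free, for a family of graphs $\mathcal{F}$, if it contains no (not necessarily induced) subgraph isomorphic to a member of $\mathcal{F}$. $\mathrm{ex}(n,H,\mathcal{F})$ is the maximum number of copies of $H$ (subgraphs isomorphic to $H$) that an $n$-vertex $\mathcal{F}$-free graph can have, with the convention that it is $0$ if there is no $\mathcal{F}$-free graph on $n$ vertices. Given a graph $H$, a set $R\subseteq V(H)$, and a positive integer $q$, $H_R^q$ is the graph obtained by taking the union of $q$ copies of $H$ such that all copies agree on the set of vertices $R$ and are otherwise disjoint. For each integer $k\ge 1$, $\mathcal{F}_{H,k}^q:=\{H_R^q: R\subsetneq V(H),\ H-R \text{ has at least } k \text{ connected components}\}$. Asymptotics are as $n\to\infty$; subscripts on $\Omega$ indicate what the implied constant may depend on. -}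

module Defs where

open import Axiom.ExcludedMiddle using (ExcludedMiddle)
open import Data.Bool using (Bool; true; false; T; _∧_)
import Data.Bool.Properties as Bool
open import Data.Fin using (Fin)
import Data.Fin as Fin
import Data.Fin.Properties as Fin
open import Data.Fin.Subset using (Subset; _∈_; _⊂_; ⊤; ∁)
open import Data.Integer using (+_)
open import Data.List using (List; []; _∷_; map; mapMaybe; filter; length; cartesianProduct; cartesianProductWith)
open import Data.List.Extrema.Nat using (max)
open import Data.Maybe using (Maybe; just; nothing)
open import Data.Nat using (ℕ; zero; suc; _≤_; _^_)
open import Data.Product using (Σ-syntax; ∃-syntax; _×_; _,_; proj₁; proj₂)
open import Data.Rational using (ℚ; 0ℚ)
import Data.Rational as ℚ
open import Data.Sum using (_⊎_; inj₁; inj₂)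
open import Data.Vec using (Vec; []; _∷_; lookup)
open import Function using (_on_)
open import Function.Bundles using (Injection; Inverse; _↔_)
open import Level using (0ℓ)
open import Relation.Binary.Bundles using (Setoid)
import Relation.Binary.Construct.Closure.Equivalence as EqClosure
open import Relation.Binary.PropositionalEquality using (_≡_; refl; sym; trans; cong; cong₂; setoid)
open import Relation.Nullary using (¬_; yes; no)
open import Relation.Nullary.Decidable using (⌊_⌋)
open import Relation.Unary using (Pred)

record SimpleGraph (V : Set) : Set where
  field
    adj        : V → V → Bool
    adj-sym    : ∀ u v → adj u v ≡ adj v u
    adj-irrefl : ∀ u → adj u u ≡ false

  _~_ : V → V → Set
  u ~ v = T (adj u v)

open SimpleGraph using (adj; adj-sym; adj-irrefl)

record _≅_ {V W : Set} (G : SimpleGraph V) (H : SimpleGraph W) : Set where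
  field
    bijection : V ↔ W
    preserves : ∀ u v → adj G u v ≡ adj H (Inverse.to bijection u) (Inverse.to bijection v)

-- Finite graphs, with vertex set normalised to an initial segment of ℕ.
record Graph : Set where
  constructor mkGraph
  field
    order : ℕ
    graph : SimpleGraph (Fin order)

open Graph

Family : Set₁
Family = Pred Graph 0ℓ

Elements : ∀ {n} → Subset n → Set
Elements {n} S = Σ[ v ∈ Fin n ] v ∈ S

induced : ∀ {n} → SimpleGraph (Fin n) → (S : Subset n) → SimpleGraph (Elements S)
induced G S = record
  { adj        = adj G on proj₁
  ; adj-sym    = λ u v → adj-sym G (proj₁ u) (proj₁ v)
  ; adj-irrefl = λ u → adj-irrefl G (proj₁ u)
  }

-- The connected components are the elements of this setoid, whose equality
-- is "joined by a path".
components : ∀ {V} → SimpleGraph V → Setoid 0ℓ 0ℓ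
components G = EqClosure.setoid (SimpleGraph._~_ G)

AtLeastComponents : ∀ {V} → ℕ → SimpleGraph V → Set
AtLeastComponents k G = Injection (setoid (Fin k)) (components G)

Matrix : ℕ → Set
Matrix n = Vec (Vec Bool n) n

entry : ∀ {n} → Matrix n → Fin n → Fin n → Bool
entry M u v = lookup (lookup M u) v

-- A vertex set and an edge set, the latter as an adjacency matrix. These are
-- first-order data, so distinct subgraphs are distinct for _≡_.
PreSubgraph : ℕ → Set
PreSubgraph n = Subset n × Matrix n

record IsSubgraph {n} (G : SimpleGraph (Fin n)) (K : PreSubgraph n) : Set where
  private
    S = proj₁ K
    E = entry (proj₂ K)
  field
    symmetric : ∀ u v → E u v ≡ E v u
    endpoints : ∀ u v → T (E u v) → u ∈ S × v ∈ S
    edges     : ∀ u v → T (E u v) → T (adj G u v)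

  toGraph : SimpleGraph (Elements S)
  toGraph = record
    { adj        = E on proj₁
    ; adj-sym    = λ u v → symmetric (proj₁ u) (proj₁ v)
    ; adj-irrefl = λ u → irrefl (proj₁ u)
    }
    where
    irrefl : ∀ u → E u u ≡ false
    irrefl u with E u u | edges u u
    ... | false | _ = refl
    ... | true  | e with adj G u u | adj-irrefl G u | e _
    ...   | false | refl | ()

IsCopyOf : ∀ {n} → Graph → SimpleGraph (Fin n) → PreSubgraph n → Set
IsCopyOf H G K = Σ[ K⊆G ∈ IsSubgraph G K ] IsSubgraph.toGraph K⊆G ≅ graph H

Contains : Graph → Graph → Set
Contains G H = ∃[ K ] IsCopyOf H (graph G) K

_-Free : Family → Graph → Set
(𝓕 -Free) G = ∀ H → 𝓕 H → ¬ Contains G H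

-- The vertices are those of R together with q disjoint copies of V(H) ∖ R.
AmalgamVertex : ∀ {n} → Subset n → ℕ → Set
AmalgamVertex R q = Elements R ⊎ (Fin q × Elements (∁ R))

amalgam : ∀ {n} → SimpleGraph (Fin n) → (R : Subset n) (q : ℕ) → SimpleGraph (AmalgamVertex R q)
amalgam H R q = record { adj = a ; adj-sym = a-sym ; adj-irrefl = a-irrefl }
  where
  a : AmalgamVertex R q → AmalgamVertex R q → Bool
  a (inj₁ (u , _))     (inj₁ (v , _))     = adj H u v
  a (inj₁ (u , _))     (inj₂ (_ , v , _)) = adj H u v
  a (inj₂ (_ , u , _)) (inj₁ (v , _))     = adj H u v
  a (inj₂ (i , u , _)) (inj₂ (j , v , _)) = ⌊ i Fin.≟ j ⌋ ∧ adj H u v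

  ≟-sym : (i j : Fin q) → ⌊ i Fin.≟ j ⌋ ≡ ⌊ j Fin.≟ i ⌋
  ≟-sym i j with i Fin.≟ j | j Fin.≟ i
  ... | yes _ | yes _ = refl
  ... | no  _ | no  _ = refl
  ... | yes p | no ¬p with () ← ¬p (sym p)
  ... | no ¬p | yes p with () ← ¬p (sym p)

  a-sym : ∀ x y → a x y ≡ a y x
  a-sym (inj₁ (u , _))     (inj₁ (v , _))     = adj-sym H u v
  a-sym (inj₁ (u , _))     (inj₂ (_ , v , _)) = adj-sym H u v
  a-sym (inj₂ (_ , u , _)) (inj₁ (v , _))     = adj-sym H u v
  a-sym (inj₂ (i , u , _)) (inj₂ (j , v , _)) = cong₂ _∧_ (≟-sym i j) (adj-sym H u v)

  a-irrefl : ∀ x → a x x ≡ false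
  a-irrefl (inj₁ (u , _))     = adj-irrefl H u
  a-irrefl (inj₂ (i , u , _)) = trans (cong (⌊ i Fin.≟ i ⌋ ∧_) (adj-irrefl H u)) (Bool.∧-zeroʳ _)

-- Closed under isomorphism, because the vertex type of an amalgam is not
-- literally of the form Fin n.
amalgams : Graph → ℕ → ℕ → Family
amalgams H k q F =
  Σ[ R ∈ Subset (order H) ]
    R ⊂ ⊤
    × AtLeastComponents k (induced (graph H) (∁ R))
    × (graph F ≅ amalgam (graph H) R q)

vecsOver : ∀ {A : Set} → List A → (n : ℕ) → List (Vec A n)
vecsOver xs zero    = [] ∷ []
vecsOver xs (suc n) = cartesianProductWith _∷_ xs (vecsOver xs n)

subsets : (n : ℕ) → List (Subset n)
subsets = vecsOver (false ∷ true ∷ [])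

matrices : (n : ℕ) → List (Matrix n)
matrices n = vecsOver (subsets n) n

preSubgraphs : (n : ℕ) → List (PreSubgraph n)
preSubgraphs n = cartesianProduct (subsets n) (matrices n)

fromMatrix : ∀ {n} → Matrix n → Maybe (SimpleGraph (Fin n))
fromMatrix M
  with Fin.all? (λ u → Fin.all? λ v → entry M u v Bool.≟ entry M v u)
     | Fin.all? (λ u → entry M u u Bool.≟ false)
... | yes s | yes i = just record { adj = entry M ; adj-sym = s ; adj-irrefl = i }
... | _     | _     = nothing

graphsOn : (n : ℕ) → List (SimpleGraph (Fin n))
graphsOn n = mapMaybe fromMatrix (matrices n)

-- Excluded middle decides which subgraphs are counted and which graphs compete
-- in the maximum; the family 𝓕 is arbitrary, so 𝓕-freeness need not be decidable.
module _ (em : ExcludedMiddle 0ℓ) where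

  copies : ∀ {n} → Graph → SimpleGraph (Fin n) → ℕ
  copies {n} H G = length (filter (λ K → em {IsCopyOf H G K}) (preSubgraphs n))

  ex : ℕ → Graph → Family → ℕ
  ex n H 𝓕 = max 0 (map (copies H) (filter (λ G → em {(𝓕 -Free) (mkGraph n G)}) (graphsOn n)))

-- f(n) ≥ c·n^k for all n ≥ n₀. "f = Ω(n^k)" asks for such c > 0 and n₀; they are
-- explicit so that a statement can say what they may depend on.
LowerBound : ℚ → ℕ → ℕ → (ℕ → ℕ) → Set
LowerBound c n₀ k f = ∀ n → n₀ ≤ n → c ℚ.* (+ (n ^ k) ℚ./ 1) ℚ.≤ + f n ℚ./ 1

{-# OPTIONS --safe #-}
-- If no p works, then for every n some 𝓕-free graph contains H_R^(q + n), where q ≈ n / |H| and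
-- H − R has at least k components. An n-vertex subgraph of H_R^(q + n) that contains H_R^q is
-- 𝓕-free and has at least q^k copies of H, because each of k components of H − R can be taken
-- independently from any of the q copies of H.
module Submission where

open import Defs
open import Axiom.ExcludedMiddle using (ExcludedMiddle)
open import Data.Nat using (ℕ; _≤_)
open import Data.Product using (∃-syntax; _×_)
open import Data.Rational using (ℚ; 0ℚ) renaming (_<_ to _<ℚ_)
open import Data.Sum using (_⊎_)
open import Level using (0ℓ)

open import Data.Bool using (Bool; true; false; T)
import Data.Bool.Properties as Bool
open import Data.Fin using (Fin; zero; suc; _↑ˡ_; _↑ʳ_; combine; finToFun; funToFin; fromℕ<; inject≤)
import Data.Fin.Properties as Fin
open import Data.Fin.Subset using (Subset; _∈_; ∁)
open import Data.Fin.Subset.Properties using (_∈?_; x∉p⇒x∈∁p; x∈∁p⇒x∉p)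
import Data.Integer as ℤ
import Data.Integer.Properties as ℤ
open import Data.List using (List; filter; length; map)
open import Data.List.Extrema.Nat using (xs≤max; max-mono-⊆)
import Data.List.Membership.Propositional as List
open import Data.List.Membership.Propositional.Properties
  using (∈-cartesianProductWith⁺; ∈-cartesianProduct⁺; ∈-filter⁺; ∈-map⁺)
open import Data.List.Membership.Setoid.Properties using (index-injective)
import Data.List.Relation.Binary.Subset.Propositional.Properties as ⊆
import Data.List.Relation.Unary.All as All
open import Data.List.Relation.Unary.Any as Any using (here; there)
open import Data.List.Relation.Unary.Any.Properties using (mapMaybe⁺)
import Data.Maybe.Relation.Unary.Any as Maybe
open import Data.Nat using (zero; suc; _+_; _*_; _^_; _/_; _%_; NonZero; >-nonZero; z≤n)
open import Data.Nat.DivMod using (m≡m%n+[m/n]*n; m%n≤n; m/n*n≤m; m≥n⇒m/n>0)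
import Data.Nat.Properties as ℕ
open import Data.Product using (Σ-syntax; _,_; proj₁; proj₂)
import Data.Rational as ℚ
import Data.Rational.Properties as ℚ
import Data.Rational.Unnormalised as ℚᵘ
import Data.Rational.Unnormalised.Properties as ℚᵘ
open import Data.Sum using (inj₁; inj₂; [_,_]′; map₂)
open import Data.Sum.Properties using (inj₂-injective)
open import Data.Vec using (Vec; []; _∷_; lookup; tabulate)
open import Data.Vec.Properties using (lookup∘tabulate; lookup⇒[]=; []=⇒lookup)
open import Data.Vec.Properties.WithK using ([]=-irrelevant)
open import Function using (_∘_; id)
open import Function.Bundles using (Injection; Inverse; Equivalence; mk⇔; mk↔ₛ′)
open import Function.Definitions using (Injective)
open import Relation.Binary.PropositionalEquality
  using (_≡_; _≢_; refl; sym; trans; cong; cong₂; subst; subst₂; setoid)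
open import Relation.Binary.Bundles using (Setoid)
open import Relation.Binary.Construct.Closure.ReflexiveTransitive using (ε; _◅_)
open import Relation.Binary.Construct.Closure.Symmetric using (fwd)
open import Relation.Nullary using (¬_; Dec; yes; no; contradiction)
open import Relation.Nullary.Decidable
  using (does; _×-dec_; T?; ⌊_⌋; toWitness; fromWitness; does-⇔; dec-true; decidable-stable; toSum)

open SimpleGraph using (adj; adj-sym; adj-irrefl)
open Graph

private
  variable
    A V W X : Set
    n k : ℕ

-- Embeddings, reflecting no edges, so that copies need not be induced.

record _↪_ (G : SimpleGraph V) (H : SimpleGraph W) : Set where
  field
    to        : V → W
    injective : Injective _≡_ _≡_ to
    homo      : ∀ u v → T (adj G u v) → T (adj H (to u) (to v))

open _↪_

↪-trans : {G : SimpleGraph V} {H : SimpleGraph W} {K : SimpleGraph X} → G ↪ H → H ↪ K → G ↪ K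
↪-trans e f = record
  { to        = to f ∘ to e
  ; injective = injective e ∘ injective f
  ; homo      = λ u v → homo f _ _ ∘ homo e u v
  }

≗⇒↪ : {G H : SimpleGraph V} → (∀ u v → adj G u v ≡ adj H u v) → G ↪ H
≗⇒↪ eq = record { to = id ; injective = id ; homo = λ u v → subst T (eq u v) }

≅⇒↩ : {G : SimpleGraph V} {H : SimpleGraph W} → G ≅ H → H ↪ G
≅⇒↩ {G = G} {H} iso = record
  { to        = from
  ; injective = λ {x} {y} eq → trans (sym (strictlyInverseˡ x)) (trans (cong to′ eq) (strictlyInverseˡ y))
  ; homo      = λ u v e → subst T (sym (preserves (from u) (from v)))
      (subst₂ (λ x y → T (adj H x y)) (sym (strictlyInverseˡ u)) (sym (strictlyInverseˡ v)) e)
  }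
  where
  open _≅_ iso
  open Inverse bijection using (from; strictlyInverseˡ) renaming (to to to′)

Elements-≡ : {S : Subset n} {x y : Elements S} → proj₁ x ≡ proj₁ y → x ≡ y
Elements-≡ {x = u , p} {.u , q} refl = cong (u ,_) ([]=-irrelevant p q)

does⇒ : {P : Set} (P? : Dec P) → does P? ≡ true → P
does⇒ (yes p) _ = p

module _ {a : ℕ} {X : SimpleGraph (Fin a)} {G : SimpleGraph (Fin n)} (e : X ↪ G) where

  private
    InImage : Fin n → Set
    InImage x = ∃[ u ] to e u ≡ x

    inImage? : ∀ x → Dec (InImage x)
    inImage? x = Fin.any? λ u → to e u Fin.≟ x

    -- Only edges coming from `X` are kept: `G` may have further edges between the same vertices,
    -- and the image has to be isomorphic to `X`.
    ImageEdge : Fin n → Fin n → Set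
    ImageEdge x y = ∃[ u ] ∃[ v ] to e u ≡ x × to e v ≡ y × T (adj X u v)

    imageEdge? : ∀ x y → Dec (ImageEdge x y)
    imageEdge? x y = Fin.any? λ u → Fin.any? λ v →
      (to e u Fin.≟ x) ×-dec (to e v Fin.≟ y) ×-dec T? (adj X u v)

  imageVertices : Subset n
  imageVertices = tabulate (does ∘ inImage?)

  image : PreSubgraph n
  image = imageVertices , tabulate λ x → tabulate λ y → does (imageEdge? x y)

  ∈-image⁺ : ∀ u → to e u ∈ imageVertices
  ∈-image⁺ u = lookup⇒[]= _ _
    (trans (lookup∘tabulate _ (to e u)) (dec-true (inImage? (to e u)) (u , refl)))

  ∈-image⁻ : ∀ {x} → x ∈ imageVertices → ∃[ u ] to e u ≡ x
  ∈-image⁻ {x} x∈ = does⇒ (inImage? x) (trans (sym (lookup∘tabulate _ x)) ([]=⇒lookup x∈))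

  private
    E : Fin n → Fin n → Bool
    E = entry (proj₂ image)

    E≡ : ∀ x y → E x y ≡ does (imageEdge? x y)
    E≡ x y = trans (cong (λ row → lookup row y) (lookup∘tabulate _ x)) (lookup∘tabulate _ y)

    E⇒ : ∀ x y → T (E x y) → ImageEdge x y
    E⇒ x y = does⇒ (imageEdge? x y) ∘ Equivalence.to Bool.T-≡ ∘ subst T (E≡ x y)

    flip-edge : ∀ {x y} → ImageEdge x y → ImageEdge y x
    flip-edge (u , v , p , q , r) = v , u , q , p , subst T (adj-sym X u v) r

  image-isSubgraph : IsSubgraph G image
  image-isSubgraph = record
    { symmetric = λ x y → trans (E≡ x y)
        (trans (does-⇔ (mk⇔ flip-edge flip-edge) (imageEdge? x y) (imageEdge? y x)) (sym (E≡ y x)))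
    ; endpoints = ends
    ; edges     = edge
    }
    where
    ends : ∀ x y → T (E x y) → x ∈ imageVertices × y ∈ imageVertices
    ends x y t with E⇒ x y t
    ... | u , v , refl , refl , _ = ∈-image⁺ u , ∈-image⁺ v
    edge : ∀ x y → T (E x y) → T (adj G x y)
    edge x y t with E⇒ x y t
    ... | u , v , refl , refl , r = homo e u v r

  image-isCopy : IsCopyOf (mkGraph a X) G image
  image-isCopy = image-isSubgraph , record
    { bijection = mk↔ₛ′ preimage (λ u → to e u , ∈-image⁺ u)
        (λ u → injective e (to-preimage (to e u , ∈-image⁺ u)))
        (λ x → Elements-≡ (to-preimage x))
    ; preserves = λ x y → trans (E≡ (proj₁ x) (proj₁ y))
        (does-⇔ (mk⇔ (pull x y) (λ t → preimage x , preimage y , to-preimage x , to-preimage y , t))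
          (imageEdge? (proj₁ x) (proj₁ y)) (T? (adj X (preimage x) (preimage y))))
    }
    where
    preimage : Elements imageVertices → Fin a
    preimage (_ , x∈) = proj₁ (∈-image⁻ x∈)
    to-preimage : ∀ x → to e (preimage x) ≡ proj₁ x
    to-preimage (_ , x∈) = proj₂ (∈-image⁻ x∈)
    pull : ∀ x y → ImageEdge (proj₁ x) (proj₁ y) → T (adj X (preimage x) (preimage y))
    pull x y (u , v , p , q , r) = subst₂ (λ u v → T (adj X u v))
      (injective e (trans p (sym (to-preimage x)))) (injective e (trans q (sym (to-preimage y)))) r

Contains⇒↪ : ∀ G H → Contains G H → graph H ↪ graph G
Contains⇒↪ G H (K , K⊆G , iso) = ↪-trans (≅⇒↩ iso) record
  { to        = proj₁
  ; injective = Elements-≡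
  ; homo      = λ u v → IsSubgraph.edges K⊆G (proj₁ u) (proj₁ v)
  }

-- A copy of `F` in `G′` is an embedding of `F`; composed with `e`, its image is a copy in `G`.
-Free-↪ : (𝓕 : Family) (G G′ : Graph) → graph G′ ↪ graph G → (𝓕 -Free) G → (𝓕 -Free) G′
-Free-↪ 𝓕 G G′ e free F F∈𝓕 c =
  let f = ↪-trans (Contains⇒↪ G′ F c) e in free F F∈𝓕 (image f , image-isCopy f)

-- Exhaustiveness of the enumerations behind `copies` and `ex`.

∈-vecsOver : {xs : List A} → (∀ x → x List.∈ xs) → (v : Vec A n) → v List.∈ vecsOver xs n
∈-vecsOver all []      = here refl
∈-vecsOver all (x ∷ v) = ∈-cartesianProductWith⁺ _∷_ (all x) (∈-vecsOver all v)

∈-subsets : (S : Subset n) → S List.∈ subsets n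
∈-subsets = ∈-vecsOver λ { false → here refl ; true → there (here refl) }

∈-matrices : (M : Matrix n) → M List.∈ matrices n
∈-matrices = ∈-vecsOver ∈-subsets

∈-preSubgraphs : (K : PreSubgraph n) → K List.∈ preSubgraphs n
∈-preSubgraphs (S , M) = ∈-cartesianProduct⁺ (∈-subsets S) (∈-matrices M)

fromMatrix-just : (M : Matrix n) → (∀ u v → entry M u v ≡ entry M v u) → (∀ u → entry M u u ≡ false) →
  Maybe.Any (λ G → ∀ u v → adj G u v ≡ entry M u v) (fromMatrix M)
fromMatrix-just M s i
  with Fin.all? (λ u → Fin.all? λ v → entry M u v Bool.≟ entry M v u)
     | Fin.all? (λ u → entry M u u Bool.≟ false)
... | yes _ | yes _ = Maybe.just λ _ _ → refl
... | yes _ | no ¬i = contradiction i ¬i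
... | no ¬s | _     = contradiction s ¬s

-- Without function extensionality, a graph is listed only up to pointwise equality of adj.
∈-graphsOn : (G : SimpleGraph (Fin n)) →
  Σ[ G′ ∈ SimpleGraph (Fin n) ] G′ List.∈ graphsOn n × (∀ u v → adj G′ u v ≡ adj G u v)
∈-graphsOn {n} G = List.find (Any.map (λ same u v → trans (same u v) (M≡ u v))
  (mapMaybe⁺ fromMatrix (matrices n) (List.lose (∈-map⁺ fromMatrix (∈-matrices M)) (fromMatrix-just M
    (λ u v → trans (M≡ u v) (trans (adj-sym G u v) (sym (M≡ v u))))
    (λ u → trans (M≡ u u) (adj-irrefl G u))))))
  where
  M : Matrix n
  M = tabulate λ u → tabulate λ v → adj G u v
  M≡ : ∀ u v → entry M u v ≡ adj G u v
  M≡ u v = trans (cong (λ row → lookup row v) (lookup∘tabulate _ u)) (lookup∘tabulate _ v)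

-- The position of `f i` in `xs` determines `f i`, so positions inject `Fin N` into the indices of
-- the list.
injection⇒≤length : {xs : List A} {N : ℕ} (f : Fin N → A) → Injective _≡_ _≡_ f →
  (∀ i → f i List.∈ xs) → N ≤ length xs
injection⇒≤length f inj f∈ = Fin.injective⇒≤ {f = Any.index ∘ f∈}
  (λ {i} {j} eq → inj (index-injective (setoid _) (f∈ i) (f∈ j) eq))

-- Copies of `H` in amalgams, and injections between amalgams and into grids.

module _ (H : SimpleGraph (Fin n)) (R : Subset n) {q : ℕ} where

  private
    side : ∀ v → v ∈ R ⊎ v ∈ ∁ R
    side v with v ∈? R
    ... | yes p = inj₁ p
    ... | no ¬p = inj₂ (x∉p⇒x∈∁p ¬p)

    underlying : AmalgamVertex R q → Fin n
    underlying (inj₁ (v , _))     = v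
    underlying (inj₂ (_ , v , _)) = v

  -- s chooses the copy of H from which a vertex outside R is taken; it is constant on the
  -- components of H − R.
  module _ (s : Elements (∁ R) → Fin q)
           (s-homo : ∀ u v → T (adj H (proj₁ u) (proj₁ v)) → s u ≡ s v) where

    private
      place : ∀ v → v ∈ R ⊎ v ∈ ∁ R → AmalgamVertex R q
      place v (inj₁ p) = inj₁ (v , p)
      place v (inj₂ p) = inj₂ (s (v , p) , v , p)

      underlying-place : ∀ v side → underlying (place v side) ≡ v
      underlying-place v (inj₁ _) = refl
      underlying-place v (inj₂ _) = refl

      place-homo : ∀ u v a b → T (adj H u v) → T (adj (amalgam H R q) (place u a) (place v b))
      place-homo u v (inj₁ _) (inj₁ _) e = e
      place-homo u v (inj₁ _) (inj₂ _) e = e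
      place-homo u v (inj₂ _) (inj₁ _) e = e
      place-homo u v (inj₂ p) (inj₂ r) e =
        Equivalence.from Bool.T-∧ (fromWitness (s-homo (u , p) (v , r) e) , e)

    -- Injectivity holds because `underlying` is a left inverse. An edge outside `R` survives
    -- because `s-homo` takes both its ends from the same copy.
    transversal : H ↪ amalgam H R q
    transversal = record
      { to        = λ v → place v (side v)
      ; injective = λ {u} {v} eq →
          trans (sym (underlying-place u (side u))) (trans (cong underlying eq) (underlying-place v (side v)))
      ; homo      = λ u v → place-homo u v (side u) (side v)
      }

    transversal-∁ : ∀ w → to transversal (proj₁ w) ≡ inj₂ (s w , w)
    transversal-∁ (v , p) with side v
    ... | inj₁ v∈R = contradiction v∈R (x∈∁p⇒x∉p p)
    ... | inj₂ _   = cong (λ w → inj₂ (s w , w)) (Elements-≡ refl)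

    -- Together with `transversal-∁`: among the `q` copies of `w`, the image contains exactly the
    -- one with index `s w`. Hence `s` can be recovered from the vertex set alone.
    transversal-∁⁻ : ∀ v j w → to transversal v ≡ inj₂ (j , w) → s w ≡ j
    transversal-∁⁻ v j w eq with side v
    transversal-∁⁻ v j w () | inj₁ _
    transversal-∁⁻ v _ _ refl | inj₂ _ = refl

module _ (H : SimpleGraph (Fin n)) (R : Subset n) where

  amalgam-↪ : {q q′ : ℕ} (f : Fin q → Fin q′) → Injective _≡_ _≡_ f → amalgam H R q ↪ amalgam H R q′
  amalgam-↪ {q} {q′} f f-inj = record { to = g ; injective = g-inj _ _ ; homo = g-homo }
    where
    g : AmalgamVertex R q → AmalgamVertex R q′
    g (inj₁ v)       = inj₁ v
    g (inj₂ (i , v)) = inj₂ (f i , v)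
    g-inj : ∀ x y → g x ≡ g y → x ≡ y
    g-inj (inj₁ _) (inj₁ _) refl = refl
    g-inj (inj₂ (i , v)) (inj₂ (j , w)) eq =
      cong inj₂ (cong₂ _,_ (f-inj (cong proj₁ (inj₂-injective eq))) (cong proj₂ (inj₂-injective eq)))
    g-homo : ∀ x y → T (adj (amalgam H R q) x y) → T (adj (amalgam H R q′) (g x) (g y))
    g-homo (inj₁ _) (inj₁ _) e = e
    g-homo (inj₁ _) (inj₂ _) e = e
    g-homo (inj₂ _) (inj₁ _) e = e
    g-homo (inj₂ (i , _)) (inj₂ (j , _)) e with Equivalence.to (Bool.T-∧ {⌊ i Fin.≟ j ⌋}) e
    ... | i≡j , e′ = Equivalence.from Bool.T-∧ (fromWitness (cong f (toWitness i≡j)) , e′)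

  -- The target holds `q` rows of `n` positions, one row per copy. Vertices of `R` go to row 0,
  -- where the copy with index 0 leaves their positions free, since it contributes only vertices of
  -- `∁ R`.
  amalgamVertex-injection : {q N : ℕ} → 1 ≤ q → q * n ≤ N →
    Σ[ ψ ∈ (AmalgamVertex R q → Fin N) ] Injective _≡_ _≡_ ψ
  amalgamVertex-injection {q} {N} 1≤q qn≤N = ψ , ψ-inj _ _
    where
    position : Fin q → Fin n → Fin N
    position i v = inject≤ (combine i v) qn≤N
    position-inj : ∀ i u j v → position i u ≡ position j v → i ≡ j × u ≡ v
    position-inj i u j v = Fin.combine-injective i u j v ∘ Fin.inject≤-injective qn≤N qn≤N _ _
    ψ : AmalgamVertex R q → Fin N
    ψ (inj₁ (v , _))     = position (fromℕ< 1≤q) v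
    ψ (inj₂ (i , v , _)) = position i v
    ψ-inj : ∀ x y → ψ x ≡ ψ y → x ≡ y
    ψ-inj (inj₁ (u , _)) (inj₁ (v , _)) eq =
      cong inj₁ (Elements-≡ (proj₂ (position-inj _ u _ v eq)))
    ψ-inj (inj₁ (u , p)) (inj₂ (j , v , r)) eq with proj₂ (position-inj _ u j v eq)
    ... | refl = contradiction p (x∈∁p⇒x∉p r)
    ψ-inj (inj₂ (i , u , p)) (inj₁ (v , r)) eq with proj₂ (position-inj i u _ v eq)
    ... | refl = contradiction r (x∈∁p⇒x∉p p)
    ψ-inj (inj₂ (i , u , _)) (inj₂ (j , v , _)) eq with position-inj i u j v eq
    ... | refl , u≡v = cong (λ w → inj₂ (i , w)) (Elements-≡ u≡v)

-- Arithmetic of rational bounds, powers and quotients.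

≤*⇒1/*≤ : {N D e : ℕ} .{{_ : NonZero D}} → N ≤ D * e →
  (ℤ.+ 1 ℚ./ D) ℚ.* (ℤ.+ N ℚ./ 1) ℚ.≤ ℤ.+ e ℚ./ 1
-- `ℚ./` reduces fractions by a gcd, so the inequality is moved to unnormalised fractions, where it
-- is plain cross-multiplication.
≤*⇒1/*≤ {N} {suc d} {e} N≤De = ℚ.toℚᵘ-cancel-≤ (begin
  ℚ.toℚᵘ ((ℤ.+ 1 ℚ./ D) ℚ.* (ℤ.+ N ℚ./ 1))
    ≃⟨ ℚ.toℚᵘ-homo-* (ℤ.+ 1 ℚ./ D) (ℤ.+ N ℚ./ 1) ⟩
  ℚ.toℚᵘ (ℤ.+ 1 ℚ./ D) ℚᵘ.* ℚ.toℚᵘ (ℤ.+ N ℚ./ 1)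
    ≃⟨ ℚᵘ.*-cong (ℚ.toℚᵘ-fromℚᵘ (ℚᵘ.mkℚᵘ (ℤ.+ 1) d)) (ℚ.toℚᵘ-fromℚᵘ (ℚᵘ.mkℚᵘ (ℤ.+ N) 0)) ⟩
  ℚᵘ.mkℚᵘ (ℤ.+ 1) d ℚᵘ.* ℚᵘ.mkℚᵘ (ℤ.+ N) 0
    ≤⟨ ℚᵘ.*≤* (subst₂ ℤ._≤_ lhs rhs (ℤ.+≤+ N≤De)) ⟩
  ℚᵘ.mkℚᵘ (ℤ.+ e) 0
    ≃⟨ ℚ.toℚᵘ-fromℚᵘ (ℚᵘ.mkℚᵘ (ℤ.+ e) 0) ⟨
  ℚ.toℚᵘ (ℤ.+ e ℚ./ 1) ∎)
  where
  open ℚᵘ.≤-Reasoning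
  D = suc d
  lhs : ℤ.+ N ≡ (ℤ.+ 1 ℤ.* ℤ.+ N) ℤ.* ℤ.+ 1
  lhs = sym (trans (ℤ.*-identityʳ _) (ℤ.*-identityˡ _))
  rhs : ℤ.+ (D * e) ≡ ℤ.+ e ℤ.* ℤ.+ (D * 1)
  rhs = trans (ℤ.pos-* D e) (trans (ℤ.*-comm (ℤ.+ D) (ℤ.+ e))
    (cong (λ m → ℤ.+ e ℤ.* ℤ.+ m) (sym (ℕ.*-identityʳ D))))

↑ˡ≢↑ʳ : ∀ {m n} (i : Fin m) (j : Fin n) → i ↑ˡ n ≢ m ↑ʳ j
↑ˡ≢↑ʳ (suc i) j = ↑ˡ≢↑ʳ i j ∘ Fin.suc-injective

-- `funToFin` is a left inverse of `finToFun` and respects pointwise equality, so function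
-- extensionality is avoided.
finToFun-injective : ∀ {m} n {i j : Fin (m ^ n)} → (∀ c → finToFun {m} {n} i c ≡ finToFun j c) → i ≡ j
finToFun-injective {m} n {i} {j} eq = trans (sym (Fin.funToFin-finToFin {n} {m} i))
  (trans (funToFin-cong n eq) (Fin.funToFin-finToFin {n} {m} j))
  where
  funToFin-cong : ∀ n {f g : Fin n → Fin m} → (∀ c → f c ≡ g c) → funToFin f ≡ funToFin g
  funToFin-cong zero    eq = refl
  funToFin-cong (suc n) eq = cong₂ combine (eq zero) (funToFin-cong n (eq ∘ suc))

*-^-distribʳ : ∀ m n k → (m * n) ^ k ≡ m ^ k * n ^ k
*-^-distribʳ m n zero    = refl
*-^-distribʳ m n (suc k) = trans (cong (m * n *_) (*-^-distribʳ m n k))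
  (ℕ.[m*n]*[o*p]≡[m*o]*[n*p] m n (m ^ k) (n ^ k))

-- The remainder is at most `m`, and `m` is at most `n / m * m` because the quotient is positive.
-- The factor 2 pays for this rounding.
n≤2m*[n/m] : ∀ {n m} .{{_ : NonZero m}} → m ≤ n → n ≤ 2 * m * (n / m)
n≤2m*[n/m] {n} {m} m≤n = begin
  n                         ≡⟨ m≡m%n+[m/n]*n n m ⟩
  n % m + n / m * m         ≤⟨ ℕ.+-monoˡ-≤ (n / m * m) (m%n≤n n m) ⟩
  m + n / m * m             ≤⟨ ℕ.+-monoˡ-≤ (n / m * m) (ℕ.m≤n*m m (n / m)) ⟩
  n / m * m + n / m * m     ≡⟨ cong (λ x → x + x) (ℕ.*-comm (n / m) m) ⟩
  m * (n / m) + m * (n / m) ≡⟨ ℕ.*-distribʳ-+ (n / m) m m ⟨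
  (m + m) * (n / m)         ≡⟨ cong (λ x → (m + x) * (n / m)) (ℕ.+-identityʳ m) ⟨
  2 * m * (n / m)           ∎
  where
  open ℕ.≤-Reasoning
  instance _ = >-nonZero (m≥n⇒m/n>0 m≤n)

AmalgamRich : Graph → ℕ → Family → ℕ → Set
AmalgamRich H k 𝓕 q = Σ[ G ∈ Graph ] (𝓕 -Free) G × (Σ[ F ∈ Graph ] amalgams H k q F × Contains G F)

-- Classical constructions and the counting of copies.

module _ (em : ExcludedMiddle 0ℓ) where

  -- A vertex takes the index of the representative in its own component. The index is unique
  -- because `ι` is injective up to connectedness, and `em` decides whether it exists.
  component-labelling : {G : SimpleGraph V} → 1 ≤ k → (ι : AtLeastComponents k G) →
    Σ[ label ∈ (V → Fin k) ]
      (∀ i → label (Injection.to ι i) ≡ i) × (∀ u v → T (adj G u v) → label u ≡ label v)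
  component-labelling {V} {k} {G} 1≤k ι = label , label-rep , label-homo
    where
    open Setoid (components G) using (_≈_) renaming (refl to ≈-refl; sym to ≈-sym; trans to ≈-trans)
    rep : Fin k → V
    rep = Injection.to ι
    Labelled : V → Set
    Labelled v = Σ[ i ∈ Fin k ] v ≈ rep i
    pick : ∀ v → Dec (Labelled v) → Fin k
    pick v (yes (i , _)) = i
    -- All components beyond the `k` represented ones share label 0.
    pick v (no _)        = fromℕ< 1≤k
    label : V → Fin k
    label v = pick v em
    -- The decisions are arguments, so that `label-rep` can compare `em` with an explicit `yes`.
    pick-≈ : ∀ u v d d′ → u ≈ v → pick u d ≡ pick v d′
    pick-≈ u v (yes (i , p)) (yes (j , r)) u≈v = Injection.injective ι (≈-trans (≈-sym p) (≈-trans u≈v r))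
    pick-≈ u v (yes (i , p)) (no ¬r)       u≈v = contradiction (i , ≈-trans (≈-sym u≈v) p) ¬r
    pick-≈ u v (no ¬p)       (yes (j , r)) u≈v = contradiction (j , ≈-trans u≈v r) ¬p
    pick-≈ u v (no _)        (no _)        u≈v = refl
    label-rep : ∀ i → label (rep i) ≡ i
    label-rep i = pick-≈ (rep i) (rep i) em (yes (i , ≈-refl)) ≈-refl
    label-homo : ∀ u v → T (adj G u v) → label u ≡ label v
    label-homo u v e = pick-≈ u v em em (fwd e ◅ ε)

  -- Points in the image of `ψ` follow `f` and all others follow `g`; disjointness of the two ranges
  -- excludes collisions.
  extend-injection : (ψ : X → Fin n) → Injective _≡_ _≡_ ψ →
    (f : X → V) → Injective _≡_ _≡_ f → (g : Fin n → V) → Injective _≡_ _≡_ g →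
    (∀ a x → f a ≢ g x) →
    Σ[ φ ∈ (Fin n → V) ] Injective _≡_ _≡_ φ × (∀ a → φ (ψ a) ≡ f a)
  extend-injection {X} {n} {V} ψ ψ-inj f f-inj g g-inj f≢g =
    (λ x → φ x em) , (λ {x} {y} → φ-inj x y em em) , λ a → φ-ψ a em
    where
    φ : ∀ x → Dec (Σ[ a ∈ X ] ψ a ≡ x) → V
    φ x (yes (a , _)) = f a
    φ x (no _)        = g x
    φ-inj : ∀ x y d d′ → φ x d ≡ φ y d′ → x ≡ y
    φ-inj x y (yes (a , p)) (yes (b , r)) eq = trans (sym p) (trans (cong ψ (f-inj eq)) r)
    φ-inj x y (yes (a , _)) (no _)        eq = contradiction eq (f≢g a y)
    φ-inj x y (no _)        (yes (b , _)) eq = contradiction (sym eq) (f≢g b x)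
    φ-inj x y (no _)        (no _)        eq = g-inj eq
    φ-ψ : ∀ a d → φ (ψ a) d ≡ f a
    φ-ψ a (yes (b , eq)) = cong f (ψ-inj eq)
    φ-ψ a (no ¬a)        = contradiction (a , refl) ¬a

  -- The vertices outside the image of H_R^q are sent to copies of w in n further copies of H.
  pad-amalgam : {h : ℕ} (H : SimpleGraph (Fin h)) (R : Subset h) → Elements (∁ R) →
    {q : ℕ} → 1 ≤ q → q * h ≤ n →
    Σ[ G ∈ SimpleGraph (Fin n) ] (amalgam H R q ↪ G) × (G ↪ amalgam H R (q + n))
  pad-amalgam {n} H R w {q} 1≤q qh≤n with amalgamVertex-injection H R 1≤q qh≤n
  ... | ψ , ψ-inj = G ,
    record { to = ψ ; injective = ψ-inj ; homo = λ a b e →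
      subst₂ (λ x y → T (adj Q x y)) (sym (φ-ψ a)) (sym (φ-ψ b)) (homo old a b e) } ,
    record { to = φ ; injective = φ-inj ; homo = λ _ _ → id }
    where
    Q : SimpleGraph (AmalgamVertex R (q + n))
    Q = amalgam H R (q + n)
    old : amalgam H R q ↪ Q
    old = amalgam-↪ H R (_↑ˡ n) (Fin.↑ˡ-injective n _ _)
    new : Fin n → AmalgamVertex R (q + n)
    new x = inj₂ (q ↑ʳ x , w)
    new-inj : Injective _≡_ _≡_ new
    new-inj eq = Fin.↑ʳ-injective q _ _ (cong proj₁ (inj₂-injective eq))
    old≢new : ∀ a x → to old a ≢ new x
    old≢new (inj₂ (i , _)) x eq = ↑ˡ≢↑ʳ i x (cong proj₁ (inj₂-injective eq))
    extension = extend-injection ψ ψ-inj (to old) (injective old) new new-inj old≢new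
    φ = proj₁ extension
    φ-inj = proj₁ (proj₂ extension)
    φ-ψ = proj₂ (proj₂ extension)
    -- Adjacency is pulled back along `φ`, which makes `φ` an embedding by construction.
    G : SimpleGraph (Fin n)
    G = record
      { adj        = λ x y → adj Q (φ x) (φ y)
      ; adj-sym    = λ x y → adj-sym Q (φ x) (φ y)
      ; adj-irrefl = λ x → adj-irrefl Q (φ x)
      }

  -- Equal images have equal vertex sets, so it suffices to tell the embeddings apart by the
  -- vertices they reach.
  ≤copies : (H : Graph) (G : SimpleGraph (Fin n)) {N : ℕ} (e : Fin N → graph H ↪ G) →
    (∀ i j → (∀ u → ∃[ v ] to (e j) v ≡ to (e i) u) → i ≡ j) → N ≤ copies em H G
  ≤copies H G e distinct = injection⇒≤length (λ i → image (e i))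
    (λ {i} {j} eq → distinct i j λ u →
      ∈-image⁻ (e j) (subst (λ K → to (e i) u ∈ proj₁ K) eq (∈-image⁺ (e i) u)))
    (λ i → ∈-filter⁺ (λ K → em) (∈-preSubgraphs (image (e i))) (image-isCopy (e i)))

  -- Each function `f` from labels to copies, coded by an element of `Fin (q ^ k)`, gives the
  -- transversal that takes vertices labelled `c` from copy `f c`.
  amalgam-copies : (H : Graph) (R : Subset (order H)) → 1 ≤ k →
    AtLeastComponents k (induced (graph H) (∁ R)) →
    {q : ℕ} {G : SimpleGraph (Fin n)} → amalgam (graph H) R q ↪ G → q ^ k ≤ copies em H G
  amalgam-copies {k = k} H R 1≤k ι {q} {G} e with component-labelling {G = induced (graph H) (∁ R)} 1≤k ι
  ... | label , label-rep , label-homo = ≤copies H G (λ i → ↪-trans (tr (finToFun i)) e)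
    (λ i j same → finToFun-injective k (agree (finToFun i) (finToFun j) same))
    where
    s : (Fin k → Fin q) → Elements (∁ R) → Fin q
    s f = f ∘ label
    s-homo : ∀ f u v → T (adj (graph H) (proj₁ u) (proj₁ v)) → s f u ≡ s f v
    s-homo f u v a = cong f (label-homo u v a)
    tr : (Fin k → Fin q) → graph H ↪ amalgam (graph H) R q
    tr f = transversal (graph H) R (s f) (s-homo f)
    -- The image of tr f contains the representative of component c in copy f c and in no other copy.
    agree : ∀ f g → (∀ u → ∃[ v ] to e (to (tr g) v) ≡ to e (to (tr f) u)) → ∀ c → f c ≡ g c
    agree f g same c with same (proj₁ (Injection.to ι c))
    ... | v , eq = subst (λ c → f c ≡ g c) (label-rep c) (sym
      (transversal-∁⁻ (graph H) R (s g) (s-homo g) v _ (Injection.to ι c)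
        (trans (injective e eq) (transversal-∁ (graph H) R (s f) (s-homo f) (Injection.to ι c)))))

  copies≤ex : (H : Graph) (𝓕 : Family) (G : SimpleGraph (Fin n)) →
    G List.∈ graphsOn n → (𝓕 -Free) (mkGraph n G) → copies em H G ≤ ex em n H 𝓕
  copies≤ex H 𝓕 G G∈ free =
    All.lookup (xs≤max 0 _) (∈-map⁺ (copies em H) (∈-filter⁺ (λ _ → em) G∈ free))

  ex-mono : (H : Graph) (𝓕 𝓖 : Family) → (∀ G → (𝓕 -Free) G → (𝓖 -Free) G) → ∀ n → ex em n H 𝓕 ≤ ex em n H 𝓖
  ex-mono H 𝓕 𝓖 sub n = max-mono-⊆ {xs = map (copies em H) (frees 𝓕)} {ys = map (copies em H) (frees 𝓖)} z≤n
    (⊆.map⁺ (copies em H) (⊆.filter⁺′ (free? 𝓕) (free? 𝓖) (λ {G} → sub (mkGraph n G)) {xs = graphsOn n} id))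
    where
    free? : (𝓗 : Family) (G : SimpleGraph (Fin n)) → Dec ((𝓗 -Free) (mkGraph n G))
    free? 𝓗 G = em
    frees : Family → List (SimpleGraph (Fin n))
    frees 𝓗 = filter (free? 𝓗) (graphsOn n)

  -- Of the `q + n` copies of `H`, the first `q` give the count and the other `n` supply padding, so
  -- the padded graph stays inside the `𝓕`-free graph `G`.
  pow≤ex : (H : Graph) (𝓕 : Family) {q : ℕ} → 1 ≤ k → 1 ≤ q → q * order H ≤ n →
    AmalgamRich H k 𝓕 (q + n) → q ^ k ≤ ex em n H 𝓕
  -- Properness of `R` yields the vertex `w` whose copies are the padding.
  pow≤ex {n = n} H 𝓕 1≤k 1≤q qh≤n (G , free , F , (R , (_ , w , _ , w∉R) , ι , iso) , G⊇F) =
    let G′ , into , out = pad-amalgam (graph H) R (w , x∉p⇒x∈∁p w∉R) 1≤q qh≤n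
        -- `ex` ranges over listed graphs, so `G′` is replaced by a listed graph with pointwise
        -- equal adjacency.
        G″ , G″∈ , same = ∈-graphsOn G′
        G″↪G = ↪-trans (≗⇒↪ same) (↪-trans out (↪-trans (≅⇒↩ iso) (Contains⇒↪ G F G⊇F)))
    in ℕ.≤-trans
      (amalgam-copies H R 1≤k ι (↪-trans into (≗⇒↪ λ u v → sym (same u v))))
      (copies≤ex H 𝓕 G″ G″∈ (-Free-↪ 𝓕 G (mkGraph n G″) G″↪G free))

proposition5p1 : (em : ExcludedMiddle 0ℓ) (H : Graph) (k : ℕ) → 1 ≤ k →
    ∃[ c ] ∃[ n₀ ] (0ℚ <ℚ c) × (∀ (𝓕 : Family) →
    (LowerBound c n₀ k (λ n → ex em n H 𝓕)
    ⊎ (∃[ q ] (1 ≤ q) × (∀ G → (𝓕 -Free) G → (amalgams H k q -Free) G)))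
    ×
    (LowerBound c n₀ k (λ n → ex em n H 𝓕)
    ⊎ (∃[ q ] (1 ≤ q) × (∀ n → ex em n H 𝓕 ≤ ex em n H (amalgams H k q)))))
proposition5p1 em H k 1≤k =
  -- Both constants are fixed before `𝓕` is given, so they depend only on `H` and `k`.
  ℤ.+ 1 ℚ./ D , m , ℚ.positive⁻¹ (ℤ.+ 1 ℚ./ D) {{ℚ.normalize-pos 1 D}} , λ 𝓕 → first 𝓕 , second 𝓕 (first 𝓕)
  where
  -- The successor allows division by `m` even when `H` has no vertices.
  m = suc (order H)
  D = (2 * m) ^ k
  instance
    D≢0 : NonZero D
    D≢0 = ℕ.m^n≢0 (2 * m) k

  Avoids : Family → ℕ → Set
  Avoids 𝓕 q = ∀ G → (𝓕 -Free) G → (amalgams H k q -Free) G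

  rich : ∀ 𝓕 → ¬ (∃[ q ] 1 ≤ q × Avoids 𝓕 q) → ∀ q → 1 ≤ q → AmalgamRich H k 𝓕 q
  -- Excluded middle turns the failure of avoidance at `q` into an actual graph.
  rich 𝓕 ¬avoids q 1≤q = decidable-stable em λ ¬rich →
    ¬avoids (q , 1≤q , λ G free F F∈ G⊇F → ¬rich (G , free , F , F∈ , G⊇F))

  bound : ∀ 𝓕 → ¬ (∃[ q ] 1 ≤ q × Avoids 𝓕 q) → ∀ n → m ≤ n → n ^ k ≤ D * ex em n H 𝓕
  bound 𝓕 ¬avoids n m≤n = begin
    n ^ k                 ≤⟨ ℕ.^-monoˡ-≤ k (n≤2m*[n/m] m≤n) ⟩
    (2 * m * (n / m)) ^ k ≡⟨ *-^-distribʳ (2 * m) (n / m) k ⟩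
    -- The number of counted copies of `H` grows with `n`: it is `n / m`, and richness is used at
    -- `n / m + n`, so the witness graph may change with `n`.
    D * (n / m) ^ k       ≤⟨ ℕ.*-monoʳ-≤ D (pow≤ex em H 𝓕 1≤k 1≤n/m [n/m]h≤n
                               (rich 𝓕 ¬avoids (n / m + n) (ℕ.≤-trans 1≤n/m (ℕ.m≤m+n _ n)))) ⟩
    D * ex em n H 𝓕       ∎
    where
    open ℕ.≤-Reasoning
    1≤n/m : 1 ≤ n / m
    1≤n/m = m≥n⇒m/n>0 m≤n
    [n/m]h≤n : n / m * order H ≤ n
    [n/m]h≤n = ℕ.≤-trans (ℕ.*-monoʳ-≤ (n / m) (ℕ.n≤1+n (order H))) (m/n*n≤m n m)

  Alternatives : Family → Set
  Alternatives 𝓕 = LowerBound (ℤ.+ 1 ℚ./ D) m k (λ n → ex em n H 𝓕) ⊎ (∃[ q ] 1 ≤ q × Avoids 𝓕 q)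

  first : ∀ 𝓕 → Alternatives 𝓕
  first 𝓕 = [ inj₂ , (λ ¬avoids → inj₁ λ n m≤n → ≤*⇒1/*≤ {D = D} {ex em n H 𝓕} (bound 𝓕 ¬avoids n m≤n)) ]′
    (toSum em)

  second : ∀ 𝓕 → Alternatives 𝓕 → LowerBound (ℤ.+ 1 ℚ./ D) m k (λ n → ex em n H 𝓕)
    ⊎ (∃[ q ] 1 ≤ q × (∀ n → ex em n H 𝓕 ≤ ex em n H (amalgams H k q)))
  second 𝓕 = map₂ λ (q , 1≤q , avoids) → q , 1≤q , ex-mono em H 𝓕 (amalgams H k q) avoids
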